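{- Let $F$ be a propositional logic formula in XNF involving $n$ logical variables $X_1,\dots,X_n$. Then the procedure XNFto2XNF (described in the context), applied to $F$, terminates after finitely many steps and returns a propositional logic formula $G$ in 2-XNF, in variables $X_1,\dots,X_n,Y_1,\dots,Y_m$ for some $m\ge 0$, such that $\mathcal{S}(F)\equiv_n \mathcal{S}(G)$.
   Context: A lineral is a formula $L_1\oplus L_2\oplus\cdots\oplus L_m$ (XOR) with literals $L_1,\dots,L_m$; the negation of a lineral is again (equivalent to) a lineral, since $\lnot(L_1\oplus L_2\oplus\cdots\oplus L_m)\equiv \lnot L_1\oplus L_2\oplus\cdots\oplus L_m$. An XNF clause is a disjunction of linerals. A formula is in XNF (XOR-OR-AND normal form) if it is a conjunction of XNF clauses, and in $k$-XNF if moreover every XNF clause involves at most $k$ linerals. Identify true with $1$ and false with $0$. For a formula $H$ in variables $Z_1,\dots,Z_N$, $\mathcal{S}(H)\subseteq\mathbb{F}_2^N$ denotes its set of satisfying assignments. For $S\subseteq\mathbb{F}_2^n$ and $T\subseteq\mathbb{F}_2^{n+m}$ write $S\equiv_n T$ if the projection $\pi:\mathbb{F}_2^{n+m}\to\mathbb{F}_2^n$, $(a_1,\dots,a_{n+m})\mapsto(a_1,\dots,a_n)$, restricts to a bijection $T\to S$. Procedure XNFto2XNF. Input: $F=\bigwedge_{k=1}^r C_k$ with XNF clauses $C_k$. Start with $i=0$ and $M=\emptyset$. For $k=1,\dots,r$: while $C_k$ contains more than two linerals, write $C_k=\bigvee_{j=1}^s L_j$ with linerals $L_j$, increase $i$ by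 $1$, let $Y_i$ be a new variable, replace $C_k$ by $Y_i\lor\bigvee_{j=3}^s L_j$, and adjoin the two clauses $(Y_i\lor\lnot L_2)$ and $(\lnot(Y_i\oplus L_1)\lor L_2)$ to $M$; when the while-loop ends, append $C_k$ to $M$. Finally return $\bigwedge M$ (the conjunction of all clauses in $M$). -}

module Defs where

open import Data.Bool.Base using (Bool; true; not; _xor_)
open import Data.Bool.ListAction using (any; all)
open import Data.Fin.Base using (Fin; fromℕ; inject≤; _↑ˡ_; _↑ʳ_)
open import Data.List.Base using (List; []; _∷_; _∷ʳ_; _++_; length; map)
open import Data.List.NonEmpty.Base as List⁺ using (List⁺; _∷_; _∷⁺_; foldr₁)
open import Data.List.Relation.Binary.Permutation.Propositional using (_↭_)
open import Data.List.Relation.Unary.All using (All)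
open import Data.Nat.Base using (ℕ; suc; _+_; _≤_)
open import Data.Nat.Properties using (n≤1+n; +-monoʳ-≤)
open import Data.Product.Base as Product using (∃; Σ-syntax; proj₁)
open import Data.Vec.Base using (Vec; lookup; take)
open import Function.Base using (_on_)
open import Function.Definitions using (Bijective)
open import Level using (0ℓ)
open import Relation.Binary.Construct.Closure.ReflexiveTransitive using (Star)
open import Relation.Binary.Core using (Rel)
open import Relation.Binary.PropositionalEquality.Core using (_≡_)
open import Relation.Unary using (Pred)

data Literal (N : ℕ) : Set where
  pos neg : Fin N → Literal N

-- The nonempty list L₁ ∷ … ∷ Lₘ stands for L₁ ⊕ ⋯ ⊕ Lₘ.
Lineral : ℕ → Set
Lineral N = List⁺ (Literal N)

-- A list of linerals stands for their disjunction.
Clause : ℕ → Set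
Clause N = List (Lineral N)

-- A list of clauses stands for their conjunction.
XNF : ℕ → Set
XNF N = List (Clause N)

_-XNF : ℕ → {N : ℕ} → Pred (XNF N) 0ℓ
(k -XNF) F = All (λ C → length C ≤ k) F

complement : ∀ {N} → Literal N → Literal N
complement (pos x) = neg x
complement (neg x) = pos x

-- ¬ (L₁ ⊕ L₂ ⊕ ⋯ ⊕ Lₘ)  is written  ¬L₁ ⊕ L₂ ⊕ ⋯ ⊕ Lₘ.
negate : ∀ {N} → Lineral N → Lineral N
negate (l ∷ ls) = complement l ∷ ls

-- 𝔽₂ is Bool, with true as 1, false as 0 and _xor_ as addition.
𝔽₂^ : ℕ → Set
𝔽₂^ N = Vec Bool N

evalLiteral : ∀ {N} → 𝔽₂^ N → Literal N → Bool
evalLiteral a (pos x) = lookup a x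
evalLiteral a (neg x) = not (lookup a x)

evalLineral : ∀ {N} → 𝔽₂^ N → Lineral N → Bool
evalLineral a L = foldr₁ _xor_ (List⁺.map (evalLiteral a) L)

evalClause : ∀ {N} → 𝔽₂^ N → Clause N → Bool
evalClause a = any (evalLineral a)

evalXNF : ∀ {N} → 𝔽₂^ N → XNF N → Bool
evalXNF a = all (evalClause a)

𝓢 : ∀ {N} → XNF N → Pred (𝔽₂^ N) 0ℓ
𝓢 F a = evalXNF a F ≡ true

-- Elements of a subset are compared as vectors, ignoring the membership proof.
_≈_ : ∀ {N} {S : Pred (𝔽₂^ N) 0ℓ} → Rel (∃ S) 0ℓ
_≈_ = _≡_ on proj₁

-- The projection onto the first n coordinates maps T into S, and its
-- restriction T → S is bijective.
infix 4 _≡ₙ_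
_≡ₙ_ : ∀ {n m} → Pred (𝔽₂^ n) 0ℓ → Pred (𝔽₂^ (n + m)) 0ℓ → Set
_≡ₙ_ {n} {m} S T =
  Σ[ π∈ ∈ (∀ {a} → T a → S (take n a)) ]
    Bijective (_≈_ {S = T}) (_≈_ {S = S}) (Product.map (take n) π∈)

mapLiteral : ∀ {N N′} → (Fin N → Fin N′) → Literal N → Literal N′
mapLiteral f (pos x) = pos (f x)
mapLiteral f (neg x) = neg (f x)

mapLineral : ∀ {N N′} → (Fin N → Fin N′) → Lineral N → Lineral N′
mapLineral f = List⁺.map (mapLiteral f)

mapClause : ∀ {N N′} → (Fin N → Fin N′) → Clause N → Clause N′
mapClause f = map (mapLineral f)

mapXNF : ∀ {N N′} → (Fin N → Fin N′) → XNF N → XNF N′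
mapXNF f = map (mapClause f)

-- In Fin (n + i) the first n elements are the variables X₁, …, Xₙ and the last
-- i are Y₁, …, Yᵢ.  `old` keeps the position of every variable already present
-- and `new` is the variable Y₍ᵢ₊₁₎.
old : ∀ n i → Fin (n + i) → Fin (n + suc i)
old n i x = inject≤ x (+-monoʳ-≤ n (n≤1+n i))

new : ∀ n i → Fin (n + suc i)
new n i = n ↑ʳ fromℕ i

-- `running i Cs M`: i new variables have been introduced, the head of Cs is the
-- current (possibly already shortened) clause Cₖ and its tail is Cₖ₊₁, …, Cᵣ.
data State (n : ℕ) : Set where
  running  : (i : ℕ) (Cs : List (Clause (n + i))) (M : List (Clause (n + i))) → State n
  returned : (m : ℕ) (G : XNF (n + m)) → State n

-- One step of XNFto2XNF.  The permutation in `split` lets the linerals of Cₖ be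
-- enumerated as L₁, …, Lₛ in any order, so the procedure is nondeterministic.
infix 4 _⟶_ _⟶*_
data _⟶_ {n : ℕ} : Rel (State n) 0ℓ where

  split : ∀ {i C Cs M} (L₁ L₂ L₃ : Lineral (n + i)) (Ls : List (Lineral (n + i))) →
          C ↭ L₁ ∷ L₂ ∷ L₃ ∷ Ls →
          let Y  = pos (new n i)
              ↑_ = mapLineral (old n i)
          in
          running i (C ∷ Cs) M ⟶
          running (suc i)
            ((List⁺.[ Y ] ∷ mapClause (old n i) (L₃ ∷ Ls)) ∷ mapXNF (old n i) Cs)
            (mapXNF (old n i) M ++
              (List⁺.[ Y ] ∷ negate (↑ L₂) ∷ []) ∷
              (negate (Y ∷⁺ ↑ L₁) ∷ ↑ L₂ ∷ []) ∷
              [])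

  append : ∀ {i C Cs M} → length C ≤ 2 →
           running i (C ∷ Cs) M ⟶ running i Cs (M ∷ʳ C)

  return : ∀ {i M} → running i [] M ⟶ returned i M

_⟶*_ : ∀ {n} → Rel (State n) 0ℓ
_⟶*_ = Star _⟶_

start : ∀ {n} → XNF n → State n
start F = running 0 (mapXNF (_↑ˡ 0) F) []

{-# OPTIONS --safe #-}

-- The clauses Y ∨ ¬L₂ and ¬(Y ⊕ L₁) ∨ L₂ adjoined by a splitting step, together
-- with the shortened clause Y ∨ L₃ ∨ ⋯ ∨ Lₛ, hold exactly if L₁ ∨ ⋯ ∨ Lₛ holds and
-- Y has the value of L₁ ∨ L₂.  Hence throughout a run the solution set of all
-- current clauses is the graph over 𝓢 F of a function e giving the values of the
-- new variables in terms of the old ones.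
module Submission where

open import Defs
open import Data.Bool.Base using (Bool; true; false; not; _∧_; _∨_; _xor_)
open import Data.Bool.ListAction using (any; all; and; or)
open import Data.Bool.Properties using (not-involutive; not-distribˡ-xor; ∧-assoc; ∨-isCommutativeMonoid)
open import Data.Fin.Base using (Fin; zero; suc; inject≤; _↑ˡ_)
open import Data.List.Base using ([]; _∷_; _++_; length; map)
import Data.List.NonEmpty.Base as List⁺
import Data.List.NonEmpty.Properties as List⁺
open import Data.List.Properties using (length-map; map-cong; map-∘; ++-assoc; ++-identityʳ)
open import Data.List.Relation.Binary.Permutation.Propositional using (_↭_; ↭-refl; ↭⇒↭ₛ)
import Data.List.Relation.Binary.Permutation.Propositional.Properties as Perm
import Data.List.Relation.Binary.Permutation.Setoid.Properties as Permₛ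
open import Data.List.Relation.Unary.All as All using ([]; _∷_)
open import Data.List.Relation.Unary.All.Properties using (++⁺; map⁺)
open import Data.Nat.Base using (ℕ; suc; _+_; _≤_; _<_; z≤n; s≤s)
open import Data.Nat.Induction using (<-wellFounded)
open import Data.Nat.ListAction using (sum)
open import Data.Nat.Properties using (≤-refl; ≤-reflexive; ≤-trans; m<n+m; n<1+n)
open import Data.Product.Base as Product using (∃; _×_; Σ-syntax; _,_; proj₁; proj₂)
open import Data.Vec.Base as Vec using ([]; _∷_; lookup; take; drop; initLast)
open import Data.Vec.Properties using (lookup-++ˡ; take++drop≡id; ∷ʳ-injective; ++-injectiveˡ)
open import Function.Base using (_∘_; flip; const)
open import Function.Bundles using (_⇔_; mk⇔; module Equivalence)
open import Induction.WellFounded using (Acc; acc; WellFounded; module Subrelation)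
open import Level using (0ℓ)
open import Relation.Binary.Construct.Closure.ReflexiveTransitive using (ε; _◅_)
import Relation.Binary.Construct.On as On
open import Relation.Binary.PropositionalEquality.Core using (_≡_; _≗_; refl; sym; trans; cong; cong₂; subst)
open import Relation.Binary.PropositionalEquality.Properties using (setoid)
open import Relation.Binary.Rewriting using (IsNormalForm; HasNormalForm)
open import Relation.Nullary.Decidable.Core using (yes; no)
open import Relation.Nullary.Negation.Core using (contradiction)
open import Relation.Unary using (Pred; Decidable)

open Equivalence using (to; from)

-- Evaluation under concatenation, permutation, renaming and negation.

all-++ : ∀ {A : Set} (p : A → Bool) xs ys → all p (xs ++ ys) ≡ all p xs ∧ all p ys
all-++ p []       ys = refl
all-++ p (x ∷ xs) ys = trans (cong (p x ∧_) (all-++ p xs ys)) (sym (∧-assoc (p x) _ _))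

-- Disjunction is a commutative monoid operation. This absorbs the free choice of enumeration in
-- `split`.
any-↭ : ∀ {A : Set} (p : A → Bool) {xs ys} → xs ↭ ys → any p xs ≡ any p ys
any-↭ p xs↭ys =
  Permₛ.foldr-commMonoid (setoid Bool) ∨-isCommutativeMonoid
    (↭⇒↭ₛ (Perm.map⁺ p xs↭ys))

module _ {N N′} (f : Fin N → Fin N′) {a : 𝔽₂^ N} {a′ : 𝔽₂^ N′}
         (a′∘f≗a : lookup a′ ∘ f ≗ lookup a) where

  evalLiteral-map : evalLiteral a′ ∘ mapLiteral f ≗ evalLiteral a
  evalLiteral-map (pos x) = a′∘f≗a x
  evalLiteral-map (neg x) = cong not (a′∘f≗a x)

  evalLineral-map : evalLineral a′ ∘ mapLineral f ≗ evalLineral a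
  evalLineral-map L = cong (List⁺.foldr₁ _xor_)
    (trans (sym (List⁺.map-∘ L)) (List⁺.map-cong evalLiteral-map L))

  evalClause-map : evalClause a′ ∘ mapClause f ≗ evalClause a
  evalClause-map C = cong or (trans (sym (map-∘ C)) (map-cong evalLineral-map C))

  evalXNF-map : evalXNF a′ ∘ mapXNF f ≗ evalXNF a
  evalXNF-map F = cong and (trans (sym (map-∘ F)) (map-cong evalClause-map F))

evalLiteral-complement : ∀ {N} (a : 𝔽₂^ N) l → evalLiteral a (complement l) ≡ not (evalLiteral a l)
evalLiteral-complement a (pos x) = refl
evalLiteral-complement a (neg x) = sym (not-involutive _)

-- Flipping one summand flips an xor. A single literal is a separate case because `foldr₁` has no
-- unit to end on.
evalLineral-negate : ∀ {N} (a : 𝔽₂^ N) L → evalLineral a (negate L) ≡ not (evalLineral a L)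
evalLineral-negate a (l List⁺.∷ [])     = evalLiteral-complement a l
evalLineral-negate a (l List⁺.∷ k ∷ ks) =
  trans (cong (_xor rest) (evalLiteral-complement a l))
        (sym (not-distribˡ-xor (evalLiteral a l) rest))
  where rest = evalLineral a (k List⁺.∷ ks)

-- Assignments extended by one new variable.

-- The inequality is arbitrary and irrelevant, so the induction is not tied to the particular proof
-- inside `old`.
lookup-old : ∀ {n i} (a : 𝔽₂^ n) (b : 𝔽₂^ i) y x .(le : n + i ≤ n + suc i) →
             lookup (a Vec.++ (b Vec.∷ʳ y)) (inject≤ x le) ≡ lookup (a Vec.++ b) x
lookup-old (_ ∷ a) b       y zero    le = refl
lookup-old (_ ∷ a) b       y (suc x) le = lookup-old a b y x _
lookup-old []      (_ ∷ b) y zero    le = refl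
lookup-old []      (_ ∷ b) y (suc x) le = lookup-old [] b y x _

lookup-new : ∀ {n i} (a : 𝔽₂^ n) (b : 𝔽₂^ i) y →
             lookup (a Vec.++ (b Vec.∷ʳ y)) (new n i) ≡ y
lookup-new (_ ∷ a) b       y = lookup-new a b y
lookup-new []      (_ ∷ b) y = lookup-new [] b y
lookup-new []      []      y = refl

-- Solution sets as graphs of functions.

IsGraph : ∀ {n m} → (𝔽₂^ n → 𝔽₂^ m) → Pred (𝔽₂^ n) 0ℓ → Pred (𝔽₂^ (n + m)) 0ℓ → Set
IsGraph e S T = ∀ a b → T (a Vec.++ b) ⇔ (S a × b ≡ e a)

-- A point of a graph is determined by its first `n` coordinates, and the point over `a` is `a`
-- followed by `e a`.
graph⇒≡ₙ : ∀ {n m} {e : 𝔽₂^ n → 𝔽₂^ m} (S : Pred (𝔽₂^ n) 0ℓ) (T : Pred (𝔽₂^ (n + m)) 0ℓ) →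
           IsGraph e S T → S ≡ₙ T
graph⇒≡ₙ {n} {e = e} S T graph =
  (λ t → proj₁ (decompose t)) , (λ {x} {y} → injective x y) , surjective
  where
  decompose : ∀ {c} → T c → S (take n c) × drop n c ≡ e (take n c)
  decompose {c} t = to (graph (take n c) (drop n c)) (subst T (sym (take++drop≡id n c)) t)

  reconstruct : ∀ {c} → T c → c ≡ take n c Vec.++ e (take n c)
  reconstruct {c} t =
    trans (sym (take++drop≡id n c)) (cong (take n c Vec.++_) (proj₂ (decompose t)))

  injective : ∀ (x y : ∃ T) → take n (proj₁ x) ≡ take n (proj₁ y) → proj₁ x ≡ proj₁ y
  injective (_ , t) (_ , u) eq =
    trans (reconstruct t) (trans (cong (λ a → a Vec.++ e a) eq) (sym (reconstruct u)))

  surjective : (y : ∃ S) →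
    Σ[ x ∈ ∃ T ] (∀ {z : ∃ T} → proj₁ z ≡ proj₁ x → take n (proj₁ z) ≡ proj₁ y)
  surjective (a , s) =
    (a Vec.++ e a , from (graph a (e a)) (s , refl)) ,
    λ { refl → ++-injectiveˡ _ a (take++drop≡id n (a Vec.++ e a)) }

-- The last coordinate is a function `g` of the earlier ones, and these depend on `a` alone through
-- `e`; substituting `e` into `g` gives the extended function.
graph-∷ʳ : ∀ {n i} {e : 𝔽₂^ n → 𝔽₂^ i} (S : Pred (𝔽₂^ n) 0ℓ)
           (T : Pred (𝔽₂^ (n + i)) 0ℓ) (T′ : Pred (𝔽₂^ (n + suc i)) 0ℓ)
           (g : 𝔽₂^ (n + i) → Bool) →
           (∀ a b y → T′ (a Vec.++ (b Vec.∷ʳ y)) ⇔ (T (a Vec.++ b) × y ≡ g (a Vec.++ b))) →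
           IsGraph e S T → IsGraph (λ a → e a Vec.∷ʳ g (a Vec.++ e a)) S T′
graph-∷ʳ {e = e} S T T′ g T′⇔T graph a b′ with initLast b′
... | b , y , refl = mk⇔ forward backward
  where
  forward : T′ (a Vec.++ (b Vec.∷ʳ y)) → S a × b Vec.∷ʳ y ≡ e a Vec.∷ʳ g (a Vec.++ e a)
  forward t′ with to (T′⇔T a b y) t′
  ... | t , refl with to (graph a b) t
  ... | s , refl = s , refl

  backward : S a × b Vec.∷ʳ y ≡ e a Vec.∷ʳ g (a Vec.++ e a) → T′ (a Vec.++ (b Vec.∷ʳ y))
  backward (s , eq) with ∷ʳ-injective b (e a) eq
  ... | refl , refl = from (T′⇔T a b y) (from (graph a b) (s , refl) , refl)

-- Here `m`, `q` and `r` are the values of the finished clauses, of `L₃ ∨ ⋯ ∨ Lₛ` and of the later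
-- clauses. If `y` is true, the second adjoined clause says `l₁ ∨ l₂`; if `y` is false, the first
-- forces `l₂` to be false and then the second forces `l₁` to be false. The trailing `false` and
-- `true` are the units on which `any` and `all` end.
split-⇔ : ∀ y l₁ l₂ m q r →
          (m ∧ (y ∨ (not l₂ ∨ false)) ∧ ((not (y xor l₁) ∨ (l₂ ∨ false)) ∧ true)) ∧ ((y ∨ q) ∧ r) ≡ true ⇔
          (m ∧ ((l₁ ∨ (l₂ ∨ q)) ∧ r) ≡ true × y ≡ l₁ ∨ l₂)
split-⇔ y l₁ l₂ m q r = mk⇔ (forward m y l₁ l₂) λ { (p , refl) → backward m l₁ l₂ p }
  where
  forward : ∀ m y l₁ l₂ {q r} →
    (m ∧ (y ∨ (not l₂ ∨ false)) ∧ ((not (y xor l₁) ∨ (l₂ ∨ false)) ∧ true)) ∧ ((y ∨ q) ∧ r) ≡ true →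
    m ∧ ((l₁ ∨ (l₂ ∨ q)) ∧ r) ≡ true × y ≡ l₁ ∨ l₂
  -- In every omitted case the hypothesis reduces to `false ≡ true`.
  forward true true  true  true  p = p , refl
  forward true true  true  false p = p , refl
  forward true true  false true  p = p , refl
  forward true false false false p = p , refl

  backward : ∀ m l₁ l₂ {q r} → m ∧ ((l₁ ∨ (l₂ ∨ q)) ∧ r) ≡ true →
    (m ∧ ((l₁ ∨ l₂) ∨ (not l₂ ∨ false)) ∧ ((not ((l₁ ∨ l₂) xor l₁) ∨ (l₂ ∨ false)) ∧ true))
      ∧ (((l₁ ∨ l₂) ∨ q) ∧ r) ≡ true
  backward true true  true  p = p
  backward true true  false p = p
  backward true false true  p = p
  backward true false false p = p

-- The invariant of a run.

vars : ∀ {n} → State n → ℕ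
vars (running i _ _) = i
vars (returned m _)  = m

done : ∀ {n} (s : State n) → XNF (n + vars s)
done (running _ _ M) = M
done (returned _ G)  = G

formula : ∀ {n} (s : State n) → XNF (n + vars s)
formula (running _ Cs M) = M ++ Cs
formula (returned _ G)   = G

IsExtension : ∀ {n} → XNF n → State n → Set
IsExtension F s = Σ[ e ∈ (𝔽₂^ _ → 𝔽₂^ (vars s)) ] IsGraph e (𝓢 F) (𝓢 (formula s))

-- Only finished clauses are bounded in length, as pending ones may still be long; in a returned
-- state `done` and `formula` coincide.
Invariant : ∀ {n} → XNF n → State n → Set
Invariant F s = (2 -XNF) (done s) × IsExtension F s

-- A `split` adds one coordinate, with value `L₁ ∨ L₂`. The other steps only regroup the list of all
-- clauses, so they keep `e`.
step-extension : ∀ {n} (F : XNF n) {s t : State n} → s ⟶ t → IsExtension F s → IsExtension F t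
step-extension {n} F (split {i} {C} {Cs} {M} L₁ L₂ L₃ Ls C↭Ls) (e , graph) =
  _ , graph-∷ʳ (𝓢 F) (𝓢 F₀) (𝓢 F₁) (λ c → evalLineral c L₁ ∨ evalLineral c L₂) equivalence graph
  where
  Y  = pos (new n i)
  ↑_ = mapLineral (old n i)
  D  = List⁺.[ Y ] ∷ mapClause (old n i) (L₃ ∷ Ls)
  D₁ = List⁺.[ Y ] ∷ negate (↑ L₂) ∷ []
  D₂ = negate (Y List⁺.∷⁺ ↑ L₁) ∷ ↑ L₂ ∷ []
  F₀ = M ++ C ∷ Cs
  F₁ = (mapXNF (old n i) M ++ D₁ ∷ D₂ ∷ []) ++ D ∷ mapXNF (old n i) Cs

  module _ (a : 𝔽₂^ n) (b : 𝔽₂^ i) (y : Bool) where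
    c  = a Vec.++ b
    c′ = a Vec.++ (b Vec.∷ʳ y)
    l₁ = evalLineral c L₁
    l₂ = evalLineral c L₂
    q  = evalClause c (L₃ ∷ Ls)

    restrict : lookup c′ ∘ old n i ≗ lookup c
    restrict x = lookup-old a b y x _

    evalY : lookup c′ (new n i) ≡ y
    evalY = lookup-new a b y

    evalD : evalClause c′ D ≡ y ∨ q
    evalD = cong₂ _∨_ evalY (evalClause-map _ restrict (L₃ ∷ Ls))

    evalD₁ : evalClause c′ D₁ ≡ y ∨ (not l₂ ∨ false)
    evalD₁ = cong₂ (λ u v → u ∨ (v ∨ false)) evalY
      (trans (evalLineral-negate c′ (↑ L₂)) (cong not (evalLineral-map _ restrict L₂)))

    evalD₂ : evalClause c′ D₂ ≡ not (y xor l₁) ∨ (l₂ ∨ false)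
    evalD₂ = cong₂ (λ u v → u ∨ (v ∨ false))
      (trans (evalLineral-negate c′ (Y List⁺.∷⁺ ↑ L₁))
             (cong₂ (λ u v → not (u xor v)) evalY (evalLineral-map _ restrict L₁)))
      (evalLineral-map _ restrict L₂)

    eval₀ : evalXNF c F₀ ≡ evalXNF c M ∧ ((l₁ ∨ (l₂ ∨ q)) ∧ evalXNF c Cs)
    eval₀ = trans (all-++ _ M (C ∷ Cs))
      (cong (λ u → evalXNF c M ∧ (u ∧ evalXNF c Cs)) (any-↭ _ C↭Ls))

    eval₁ : evalXNF c′ F₁ ≡
      (evalXNF c M ∧ (y ∨ (not l₂ ∨ false)) ∧ ((not (y xor l₁) ∨ (l₂ ∨ false)) ∧ true))
        ∧ ((y ∨ q) ∧ evalXNF c Cs)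
    eval₁ = trans (all-++ _ (mapXNF (old n i) M ++ D₁ ∷ D₂ ∷ []) (D ∷ mapXNF (old n i) Cs))
      (cong₂ _∧_
        (trans (all-++ _ (mapXNF (old n i) M) (D₁ ∷ D₂ ∷ []))
          (cong₂ _∧_ (evalXNF-map _ restrict M) (cong₂ (λ u v → u ∧ (v ∧ true)) evalD₁ evalD₂)))
        (cong₂ _∧_ evalD (evalXNF-map _ restrict Cs)))

    equivalence : 𝓢 F₁ c′ ⇔ (𝓢 F₀ c × y ≡ l₁ ∨ l₂)
    equivalence = mk⇔
      (Product.map₁ (trans eval₀) ∘ to boolean ∘ trans (sym eval₁))
      (trans eval₁ ∘ from boolean ∘ Product.map₁ (trans (sym eval₀)))
      where boolean = split-⇔ y l₁ l₂ (evalXNF c M) q (evalXNF c Cs)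
step-extension F (append {C = C} {Cs} {M} _) (e , graph) =
  e , subst (λ G → IsGraph e (𝓢 F) (𝓢 G)) (sym (++-assoc M (C ∷ []) Cs)) graph
step-extension F (return {M = M}) (e , graph) =
  e , subst (λ G → IsGraph e (𝓢 F) (𝓢 G)) (++-identityʳ M) graph

step-2-XNF : ∀ {n} {s t : State n} → s ⟶ t → (2 -XNF) (done s) → (2 -XNF) (done t)
step-2-XNF (split _ _ _ _ _) M≤2 =
  -- Renaming preserves lengths, and both adjoined clauses have exactly two linerals.
  ++⁺ (map⁺ (All.map (λ {C} → ≤-trans (≤-reflexive (length-map _ C))) M≤2)) (≤-refl ∷ ≤-refl ∷ [])
step-2-XNF (append C≤2) M≤2 = ++⁺ M≤2 (C≤2 ∷ [])
step-2-XNF return M≤2 = M≤2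

steps-invariant : ∀ {n} (F : XNF n) {s t : State n} → s ⟶* t → Invariant F s → Invariant F t
steps-invariant F ε              inv         = inv
steps-invariant F (s⟶u ◅ u⟶*t) (≤2 , ext) =
  steps-invariant F u⟶*t (step-2-XNF s⟶u ≤2 , step-extension F s⟶u ext)

start-invariant : ∀ {n} (F : XNF n) → Invariant F (start F)
start-invariant {n} F = [] , const [] , graph
  where
  graph : IsGraph (const []) (𝓢 F) (𝓢 (mapXNF (_↑ˡ 0) F))
  graph a [] = mk⇔ (λ t → trans (sym eval) t , refl) (trans eval ∘ proj₁)
    where eval = evalXNF-map (_↑ˡ 0) (lookup-++ˡ a []) F

-- Termination.

-- The extra one per clause makes the weight drop even when an empty clause is appended.
weight : ∀ {N} → XNF N → ℕ
weight = sum ∘ map (suc ∘ length)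

weight-map : ∀ {N N′} (f : Fin N → Fin N′) F → weight (mapXNF f F) ≡ weight F
weight-map f F = cong sum (trans (sym (map-∘ F)) (map-cong (cong suc ∘ length-map (mapLineral f)) F))

-- The `suc` for running states makes `return` decrease the size as well.
size : ∀ {n} → State n → ℕ
size (running _ Cs _) = suc (weight Cs)
size (returned _ _)   = 0

step-size : ∀ {n} {s t : State n} → s ⟶ t → size t < size s
step-size {n} (split {i} {Cs = Cs} L₁ L₂ L₃ Ls C↭Ls)
  -- Two linerals are replaced by the single `Y`, so the size drops by exactly one.
  rewrite weight-map (old n i) Cs | length-map (mapLineral (old n i)) Ls | Perm.↭-length C↭Ls = n<1+n _
step-size (append {C = C} _) = s≤s (m<n+m _ (s≤s z≤n))
step-size return             = s≤s z≤n

-- Each step lowers a natural number, so every run is finite, whatever enumerations it chooses.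
⟶-wellFounded : ∀ {n} → WellFounded (flip (_⟶_ {n}))
⟶-wellFounded = Subrelation.wellFounded step-size (On.wellFounded size <-wellFounded)

-- Normal forms and correctness.

-- A clause with at most two linerals can be appended and a longer one can be split in its given
-- order. Hence a run can only get stuck in a returned state.
running-reducible : ∀ {n} i Cs M → ∃ (running {n} i Cs M ⟶_)
running-reducible i []                       M = _ , return
running-reducible i ([] ∷ _)                 M = _ , append z≤n
running-reducible i ((_ ∷ []) ∷ _)           M = _ , append (s≤s z≤n)
running-reducible i ((_ ∷ _ ∷ []) ∷ _)       M = _ , append ≤-refl
running-reducible i ((L₁ ∷ L₂ ∷ L₃ ∷ Ls) ∷ _) M = _ , split L₁ L₂ L₃ Ls ↭-refl

reducible? : ∀ {n} → Decidable (λ (s : State n) → ∃ (s ⟶_))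
reducible? (running i Cs M) = yes (running-reducible i Cs M)
reducible? (returned m G)   = no λ ()

normalise : ∀ {n} {s : State n} → Acc (flip _⟶_) s → HasNormalForm _⟶_ s
normalise {s = s} (acc rec) with reducible? s
... | no irreducible = s , irreducible , ε
... | yes (t , s⟶t) =
  let u , irreducible , t⟶*u = normalise (rec s⟶t) in u , irreducible , s⟶t ◅ t⟶*u

proposition3p7 : ∀ (n : ℕ) (F : XNF n) →
    Acc (flip _⟶_) (start F) ×
    HasNormalForm _⟶_ (start F) ×
    (∀ {s : State n} → start F ⟶* s → IsNormalForm _⟶_ s →
    Σ[ m ∈ ℕ ] Σ[ G ∈ XNF (n + m) ]
    s ≡ returned m G × (2 -XNF) G × 𝓢 F ≡ₙ 𝓢 G)
proposition3p7 n F = terminates , normalise terminates , correct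
  where
  terminates : Acc (flip _⟶_) (start F)
  terminates = ⟶-wellFounded (start F)

  correct : ∀ {s : State n} → start F ⟶* s → IsNormalForm _⟶_ s →
    Σ[ m ∈ ℕ ] Σ[ G ∈ XNF (n + m) ] s ≡ returned m G × (2 -XNF) G × 𝓢 F ≡ₙ 𝓢 G
  correct {running i Cs M} _ irreducible = contradiction (running-reducible i Cs M) irreducible
  correct {returned m G} start⟶*s _ =
    let G≤2 , _ , graph = steps-invariant F start⟶*s (start-invariant F)
    in m , G , refl , G≤2 , graph⇒≡ₙ (𝓢 F) (𝓢 G) graph
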